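{- There exists a function $f$ such that every graph $G$ satisfies $\chi_{\mathrm{so}}(G)\leq f(\operatorname{rtw}(G))$.
   Context: All graphs are finite and simple. For an integer $k\geq 0$, a \emph{$k$-tree} is defined recursively: a clique on $k$ vertices is a $k$-tree, and a graph obtained from a $k$-tree by adding a new vertex adjacent to all vertices of an existing $k$-clique is a $k$-tree. The \emph{strong product} $H\boxtimes H'$ has vertex set $V(H)\times V(H')$, with distinct $(u,x),(v,y)$ adjacent iff ($u=v$ or $uv\in E(H)$) and ($x=y$ or $xy\in E(H')$). The \emph{row-treewidth} $\operatorname{rtw}(G)$ is the minimum $k$ such that there exist a $k$-tree $H$ and a path $P$ with $G$ isomorphic to a subgraph of $H\boxtimes P$. A proper vertex-coloring $\varphi\colon V(G)\to[t]$ is \emph{strong odd} if for every vertex $v$ and color $i$ the number $|N(v)\cap\varphi^{ -1}(i)|$ is zero or odd; $\chi_{\mathrm{so}}(G)$ is the minimum number of colors of a strong odd coloring of $G$. -}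

module Defs where

open import Data.Nat using (ℕ; zero; suc; _+_; _<_; _%_)
open import Data.Nat.Base using (∣_-_∣)
open import Data.Bool using (Bool; true; false; not; _∧_; if_then_else_)
open import Data.Fin using (Fin; zero; suc; toℕ)
import Data.Fin as Fin
open import Data.Fin.Subset using (Subset; _∈_; ∣_∣)
open import Data.Vec using (lookup)
open import Data.Product using (Σ; _×_; _,_; ∃)
open import Data.Sum using (_⊎_)
open import Function.Definitions using (Injective)
open import Relation.Nullary using (¬_)
open import Relation.Nullary.Decidable using (⌊_⌋)
open import Relation.Binary.PropositionalEquality using (_≡_; _≢_)

Adj : ℕ → Set
Adj n = Fin n → Fin n → Bool

record Graph : Set where
  field
    size  : ℕ
    adj   : Adj size
    sym   : ∀ u v → adj u v ≡ adj v u
    irrefl : ∀ v → adj v v ≡ false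
open Graph public

complete : (k : ℕ) → Adj k
complete k u v = not ⌊ u Fin.≟ v ⌋

extend : ∀ {n} → Adj n → Subset n → Adj (suc n)
extend a S zero    zero    = false
extend a S zero    (suc v) = lookup S v
extend a S (suc u) zero    = lookup S u
extend a S (suc u) (suc v) = a u v

IsClique : ∀ {n} → Adj n → ℕ → Subset n → Set
IsClique a k S = (∣ S ∣ ≡ k) × (∀ u v → u ∈ S → v ∈ S → u ≢ v → a u v ≡ true)

-- k-trees (vertex labelling is immaterial since we only use them up to
-- the existence of an embedding below).
data KTree (k : ℕ) : (n : ℕ) → Adj n → Set where
  base : KTree k k (complete k)
  step : ∀ {n a} (S : Subset n) → KTree k n a → IsClique a k S →
         KTree k (suc n) (extend a S)

pathAdj : (m : ℕ) → Fin m → Fin m → Set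
pathAdj m x y = ∣ toℕ x - toℕ y ∣ ≡ 1

StrongAdj : ∀ {h m} → Adj h → Fin h × Fin m → Fin h × Fin m → Set
StrongAdj {h} {m} a (u , x) (v , y) =
  ((u , x) ≢ (v , y)) × ((u ≡ v) ⊎ (a u v ≡ true)) × ((x ≡ y) ⊎ pathAdj m x y)

SubgraphOfProduct : (G : Graph) → ∀ {h} → Adj h → ℕ → Set
SubgraphOfProduct G {h} a m =
  Σ (Fin (size G) → Fin h × Fin m) λ g →
    Injective _≡_ _≡_ g × (∀ u v → adj G u v ≡ true → StrongAdj a (g u) (g v))

RowTreewidthWitness : Graph → ℕ → Set
RowTreewidthWitness G k =
  Σ ℕ λ h → Σ (Adj h) λ a → KTree k h a × Σ ℕ λ m → SubgraphOfProduct G a m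

IsRowTreewidth : Graph → ℕ → Set
IsRowTreewidth G k = RowTreewidthWitness G k × (∀ j → j < k → ¬ RowTreewidthWitness G j)

count : ∀ {n} → (Fin n → Bool) → ℕ
count {zero}  p = 0
count {suc n} p = (if p zero then 1 else 0) + count (λ u → p (suc u))

colorNbrs : (G : Graph) → ∀ {t} → (Fin (size G) → Fin t) → Fin (size G) → Fin t → ℕ
colorNbrs G φ v i = count (λ u → adj G v u ∧ ⌊ φ u Fin.≟ i ⌋)

IsStrongOddColoring : (G : Graph) → ∀ {t} → (Fin (size G) → Fin t) → Set
IsStrongOddColoring G φ =
  (∀ u v → adj G u v ≡ true → φ u ≢ φ v) ×
  (∀ v i → (colorNbrs G φ v i ≡ 0) ⊎ (colorNbrs G φ v i % 2 ≡ 1))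

StrongOddColorable : Graph → ℕ → Set
StrongOddColorable G t = Σ (Fin (size G) → Fin t) λ φ → IsStrongOddColoring G φ

IsStrongOddChromatic : Graph → ℕ → Set
IsStrongOddChromatic G c = StrongOddColorable G c × (∀ j → j < c → ¬ StrongOddColorable G j)

{-# OPTIONS --safe #-}

-- Order V(G) and call the larger neighbours of w its parents.  In H ⊠ P, ordered so that the older
-- vertices of the k-tree H are larger, there is a colouring c with boundedly many colours (colour in H, row
-- modulo 5) that is injective on every set of vertices strongly 2-reachable from a given vertex
-- and separates every vertex from its grandparents.  Let a₀ w = w and let aⱼ w be the j-th nearest
-- parent of w.  Since a₍ⱼ₊₁₎ w is 2-reachable from aⱼ w, it is determined by aⱼ w and its colour:
-- among the vertices w with a fixed profile (c (a₀ w), c (a₁ w), …), the fibres of a₀, a₁, a₂, …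
-- are successively coarser partitions.  The children of v with a given profile form a single fibre
-- of some aⱼ, so it suffices to refine the profile so that every fibre of every aⱼ meets every
-- colour class in zero or an odd number of vertices.  This is done from fine to coarse at the cost
-- of one bit per level: if a fibre of a₍ⱼ₊₁₎ meets a colour class evenly but not trivially, recolour
-- that class on one of the fibres of aⱼ inside it, which is an odd number of vertices; the fibres of
-- a₀, …, aⱼ only see a colour being renamed.

module Submission where

open import Defs hiding (sym)
open import Data.Nat using (ℕ; zero; suc; _+_; _*_; _^_; _≤_; _<_; _%_; _/_; ∣_-_∣; z≤n; s≤s)
import Data.Nat as ℕ
import Data.Nat.Properties as ℕₚ
open import Data.Nat.DivMod using (%-distribˡ-+; m%n<n; m≡m%n+[m/n]*n)
open import Data.Bool using (Bool; true; false; not; _∧_; T)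
import Data.Bool as Bool
open import Data.Bool.Properties using (T-∧; T-≡; T-not-≡; T?)
open import Data.Fin using (Fin; zero; suc; combine; toℕ; fromℕ<; inject≤; funToFin; finToFun)
import Data.Fin as Fin
import Data.Fin.Properties as Finₚ
open import Data.Fin.Subset using (Subset) renaming (∣_∣ to card)
open import Data.List using (List; []; _∷_; map; _++_; concatMap; length; allFin)
import Data.List as List
import Data.List.Properties as Listₚ
open import Data.List.Membership.Propositional using (_∈_; _∉_; lose)
open import Data.List.Membership.Propositional.Properties
  using (∈-map⁺; ∈-++⁺ˡ; ∈-++⁺ʳ; ∈-concatMap⁺; ∈-allFin)
import Data.List.Membership.DecPropositional as DecMembership
open import Data.List.Relation.Unary.Any using (here; there; index)
open import Data.List.Relation.Unary.Any.Properties using (lookup-index)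
open import Data.Vec using ([]; _∷_; lookup)
open import Data.Vec.Properties using (lookup⇒[]=)
open import Data.Product using (Σ; _×_; _,_; proj₁; proj₂; ∃)
open import Data.Sum using (_⊎_; inj₁; inj₂)
open import Data.Unit using (tt)
open import Function using (_∘_; _⇔_; mk⇔; Equivalence)
open import Relation.Nullary using (¬_; Dec; yes; no; contradiction)
open import Relation.Nullary.Decidable using (⌊_⌋; toWitness; fromWitness; _×-dec_)
open import Relation.Unary using (Decidable)
open import Relation.Binary using (tri<; tri≈; tri>)
open import Relation.Binary.PropositionalEquality
open Equivalence using (to; from)

-- Refining a colouring along a chain of partitions

OddOrZero : ℕ → Set
OddOrZero m = m ≡ 0 ⊎ m % 2 ≡ 1

T-⇔⇒≡ : ∀ {x y} → T x ⇔ T y → x ≡ y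
T-⇔⇒≡ {true}  {true}  _ = refl
T-⇔⇒≡ {true}  {false} f with () ← to f tt
T-⇔⇒≡ {false} {true}  f with () ← from f tt
T-⇔⇒≡ {false} {false} _ = refl

count-cong : ∀ {n} (p q : Fin n → Bool) → (∀ w → T (p w) ⇔ T (q w)) → count p ≡ count q
count-cong {zero}  p q p⇔q = refl
count-cong {suc n} p q p⇔q rewrite T-⇔⇒≡ (p⇔q zero) =
  cong (_ +_) (count-cong (p ∘ suc) (q ∘ suc) (p⇔q ∘ suc))

Odd-cong : ∀ {n} (p q : Fin n → Bool) → (∀ w → T (p w) ⇔ T (q w)) →
  count q % 2 ≡ 1 → count p % 2 ≡ 1
Odd-cong p q p⇔q = trans (cong (_% 2) (count-cong p q p⇔q))

count-none : ∀ {n} (p : Fin n → Bool) → (∀ w → ¬ T (p w)) → count p ≡ 0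
count-none {zero}  p ∄ = refl
count-none {suc n} p ∄ with p zero | ∄ zero
... | true  | ¬tt = contradiction tt ¬tt
... | false | _   = count-none (p ∘ suc) (∄ ∘ suc)

count-some : ∀ {n} {p : Fin n → Bool} w → T (p w) → count p ≢ 0
count-some {p = p} zero    pw eq with true ← p zero | () ← eq
count-some {p = p} (suc w) pw eq = count-some w pw (ℕₚ.m+n≡0⇒n≡0 _ eq)

count-unique : ∀ {n} {p : Fin n → Bool} →
  (∀ w w′ → T (p w) → T (p w′) → w ≡ w′) → OddOrZero (count p)
count-unique {zero}  _ = inj₁ refl
count-unique {suc n} {p} unique with p zero | unique zero
... | true  | ! = inj₂ (cong (λ m → suc m % 2) (count-none _ λ w pw → Finₚ.0≢1+n (! (suc w) tt pw)))
... | false | _ = count-unique λ w w′ pw pw′ → Finₚ.suc-injective (unique (suc w) (suc w′) pw pw′)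

count-split : ∀ {n} (p r : Fin n → Bool) →
  count p ≡ count (λ w → p w ∧ r w) + count (λ w → p w ∧ not (r w))
count-split {zero}  p r = refl
count-split {suc n} p r with p zero | r zero | count-split (p ∘ suc) (r ∘ suc)
... | true  | true  | eq = cong suc eq
... | true  | false | eq = trans (cong suc eq) (sym (ℕₚ.+-suc _ _))
... | false | _     | eq = eq

odd-cancelˡ : ∀ m n → (m + n) % 2 ≡ 0 → m % 2 ≡ 1 → n % 2 ≡ 1
odd-cancelˡ m n m+n-even m-odd with n % 2 | m%n<n n 2 | %-distribˡ-+ m n 2
... | 0 | _ | eq rewrite m-odd with () ← trans (sym m+n-even) eq
... | 1 | _ | _ = refl
... | suc (suc _) | s≤s (s≤s ()) | _

odd-or-even : ∀ m → m % 2 ≡ 1 ⊎ m % 2 ≡ 0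
odd-or-even m with m % 2 | m%n<n m 2
... | 0 | _ = inj₂ refl
... | 1 | _ = inj₁ refl
... | suc (suc _) | s≤s (s≤s ())

-- Fibres inside colour classes, and one step of coarsening.

fibre : ∀ {n N} → (Fin n → Fin n) → (Fin n → Fin N) → Fin n → Fin N → Fin n → Bool
fibre a e v i w = ⌊ a w Fin.≟ v ⌋ ∧ ⌊ e w Fin.≟ i ⌋

T-⌊⌋∧⌊⌋ : ∀ {P Q : Set} (P? : Dec P) (Q? : Dec Q) → T (⌊ P? ⌋ ∧ ⌊ Q? ⌋) ⇔ (P × Q)
T-⌊⌋∧⌊⌋ (yes p) (yes q) = mk⇔ (λ _ → p , q) _
T-⌊⌋∧⌊⌋ (yes p) (no ¬q) = mk⇔ (λ ()) (λ (_ , q) → ¬q q)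
T-⌊⌋∧⌊⌋ (no ¬p) _       = mk⇔ (λ ()) (λ (p , _) → ¬p p)

∈-fibre : ∀ {n N} (a : Fin n → Fin n) (e : Fin n → Fin N) {v i w} →
  T (fibre a e v i w) ⇔ (a w ≡ v × e w ≡ i)
∈-fibre a e {v} {i} {w} = T-⌊⌋∧⌊⌋ (a w Fin.≟ v) (e w Fin.≟ i)

Good : ∀ {n N} → (Fin n → Fin n) → (Fin n → Fin N) → Set
Good a e = ∀ v i → OddOrZero (count (fibre a e v i))

-- Inside every colour class of `e`, the partition into fibres of `a` refines the partition into
-- fibres of `b`.
Determines : ∀ {n N} {B : Set} → (Fin n → Fin N) → (Fin n → Fin n) → (Fin n → B) → Set
Determines e a b = ∀ w w′ → e w ≡ e w′ → a w ≡ a w′ → b w ≡ b w′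

bit : Bool → Fin 2
bit false = zero
bit true  = suc zero

bit-injective : ∀ {x y} → bit x ≡ bit y → x ≡ y
bit-injective {false} {false} _ = refl
bit-injective {true}  {true}  _ = refl

bit-surjective : ∀ c → ∃ λ x → bit x ≡ c
bit-surjective zero       = false , refl
bit-surjective (suc zero) = true , refl

mark : ∀ {n N} → (Fin n → Fin N) → (Fin n → Bool) → Fin n → Fin (N * 2)
mark e β w = combine (e w) (bit (β w))

mark-injective : ∀ {n N} (e : Fin n → Fin N) (β : Fin n → Bool) {w} i x →
  mark e β w ≡ combine i (bit x) → e w ≡ i × β w ≡ x
mark-injective e β i x eq = let p , q = Finₚ.combine-injective _ _ i (bit x) eq in p , bit-injective q

∈-fibre-mark : ∀ {n N} (a : Fin n → Fin n) (e : Fin n → Fin N) (β : Fin n → Bool) {v w} i x →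
  T (fibre a (mark e β) v (combine i (bit x)) w) ⇔ (T (fibre a e v i w) × β w ≡ x)
∈-fibre-mark a e β i x = mk⇔
  (λ t → let p , q = to (∈-fibre a (mark e β)) t ; r , s = mark-injective e β i x q
         in from (∈-fibre a e) (p , r) , s)
  (λ (t , s) → let p , r = to (∈-fibre a e) t
               in from (∈-fibre a (mark e β)) (p , cong₂ combine r (cong bit s)))

mark-surjective : ∀ {N} (i′ : Fin (N * 2)) → ∃ λ (i : Fin N) → ∃ λ x → combine i (bit x) ≡ i′
mark-surjective {N} i′ with i , c , refl ← Finₚ.combine-surjective {N} {2} i′
  with x , refl ← bit-surjective c = i , x , refl

-- As `β` is constant on each fibre of `a` within a colour class, the new bit merely renames a
-- colour there: a nonempty fibre for `mark e β` is a whole fibre for `e`.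
good-mark : ∀ {n N} {a : Fin n → Fin n} {e : Fin n → Fin N} {β : Fin n → Bool} →
  Determines e a β → Good a e → Good a (mark e β)
good-mark {N = N} {a} {e} {β} det good v i′
  with i , x , refl ← mark-surjective {N} i′
  with Finₚ.any? (λ w → T? (fibre a (mark e β) v (combine i (bit x)) w))
... | no ∄ = inj₁ (count-none _ λ w t → ∄ (w , t))
... | yes (w₀ , t₀) = subst OddOrZero (count-cong _ _ λ w → mk⇔
  (λ t → from (∈-fibre-mark a e β i x) (t , trans (same w t) (proj₂ s₀)))
  (proj₁ ∘ to (∈-fibre-mark a e β i x))) (good v i)
  where
  s₀ = to (∈-fibre-mark a e β i x) t₀
  same : ∀ w → T (fibre a e v i w) → β w ≡ β w₀
  same w t = let p , q = to (∈-fibre a e) t ; p₀ , q₀ = to (∈-fibre a e) (proj₁ s₀)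
             in det w w₀ (trans q (sym q₀)) (trans p (sym p₀))

module Coarsen {n N} (a b : Fin n → Fin n) (e : Fin n → Fin N)
               (det : Determines e a b) (good : Good a e) where

  -- On an empty fibre the value `v` is an arbitrary default.
  representative : Fin n → Fin N → Fin n
  representative v i with Finₚ.any? (λ w → T? (fibre b e v i w))
  ... | yes (w , _) = w
  ... | no  _       = v

  representative-∈ : ∀ {v i w} → T (fibre b e v i w) → T (fibre b e v i (representative v i))
  representative-∈ {v} {i} t with Finₚ.any? (λ w → T? (fibre b e v i w))
  ... | yes (_ , s) = s
  ... | no  ∄       = contradiction (_ , t) ∄

  special : Fin n → Fin N → Fin n → Bool
  special v i w = ⌊ a w Fin.≟ a (representative v i) ⌋

  -- Selects, in each fibre of `b` of even size, the one fibre of `a` through the representative;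
  -- fibres of odd size are left alone.
  β : Fin n → Bool
  β w = ⌊ count (fibre b e (b w) (e w)) % 2 ℕ.≟ 0 ⌋ ∧ special (b w) (e w) w

  β-det : Determines e a β
  β-det w w′ p q rewrite det w w′ p q | p | q = refl

  β-even : ∀ {v i w} → count (fibre b e v i) % 2 ≡ 0 → T (fibre b e v i w) → β w ≡ special v i w
  β-even {v} {i} {w} even t with refl , refl ← to (∈-fibre b e {v} {i} {w}) t rewrite even = refl

  β-odd : ∀ {v i w} → count (fibre b e v i) % 2 ≡ 1 → T (fibre b e v i w) → β w ≡ false
  β-odd {v} {i} {w} odd t with refl , refl ← to (∈-fibre b e {v} {i} {w}) t rewrite odd = refl

  -- By `det` the fibre of `a` through the representative stays inside the fibre of `b`, so the
  -- special vertices form a whole fibre of `a`. It contains the representative, hence is odd by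
  -- `good`.
  special-odd : ∀ {v i w} → T (fibre b e v i w) →
    count (λ w → fibre b e v i w ∧ special v i w) % 2 ≡ 1
  special-odd {v} {i} t = go (good (a w₀) i)
    where
    w₀ = representative v i
    ∈₀ = to (∈-fibre b e {v} {i} {w₀}) (representative-∈ t)
    F∧S⇔A : ∀ w → T (fibre b e v i w ∧ special v i w) ⇔ T (fibre a e (a w₀) i w)
    F∧S⇔A w = mk⇔
      (λ t → let p , q = to (T-∧ {fibre b e v i w}) t
             in from (∈-fibre a e) (toWitness q , proj₂ (to (∈-fibre b e) p)))
      (λ t → let p , q = to (∈-fibre a e) t
             in from T-∧ ( from (∈-fibre b e) (trans (det w w₀ (trans q (sym (proj₂ ∈₀))) p) (proj₁ ∈₀) , q)
                         , fromWitness p))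
    go : OddOrZero (count (fibre a e (a w₀) i)) → _
    go (inj₁ none) = contradiction none (count-some w₀ (from (∈-fibre a e) (refl , proj₂ ∈₀)))
    go (inj₂ odd)  = Odd-cong _ _ F∧S⇔A odd

  -- A fibre of odd size gets the bit `false` throughout and survives whole. A nonempty one of even
  -- size splits into its special part, which is odd, and the rest, which is odd as an even number
  -- minus an odd one.
  good-coarse : Good b (mark e β)
  good-coarse v i′ with i , x , refl ← mark-surjective {N} i′ = cases x
    where
    F = fibre b e v i
    S = special v i
    F′ : Bool → Fin n → Bool
    F′ x = fibre b (mark e β) v (combine i (bit x))
    ∈F′ : ∀ x {w} → T (F′ x w) ⇔ (T (F w) × β w ≡ x)
    ∈F′ x = ∈-fibre-mark b e β i x
    cases : ∀ x → OddOrZero (count (F′ x))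
    cases x with Finₚ.any? (λ w → T? (F w))
    ... | no ∄ = inj₁ (count-none _ λ w t → ∄ (w , proj₁ (to (∈F′ x) t)))
    ... | yes (w₀ , t₀) with odd-or-even (count F)
    cases false | yes _ | inj₁ odd = inj₂ (Odd-cong _ F (λ w → mk⇔
      (proj₁ ∘ to (∈F′ false))
      (λ t → from (∈F′ false) (t , β-odd odd t))) odd)
    cases true | yes _ | inj₁ odd = inj₁ (count-none (F′ true) λ w t →
      let p , q = to (∈F′ true) t in contradiction (trans (sym q) (β-odd odd p)) λ ())
    cases true | yes (_ , t₀) | inj₂ even = inj₂ (Odd-cong _ (λ w → F w ∧ S w) (λ w → mk⇔
      (λ t → let p , q = to (∈F′ true) t
             in from T-∧ (p , from T-≡ (trans (sym (β-even even p)) q)))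
      (λ t → let p , q = to (T-∧ {F w}) t
             in from (∈F′ true) (p , trans (β-even even p) (to T-≡ q))))
      (special-odd t₀))
    cases false | yes (_ , t₀) | inj₂ even = inj₂ (Odd-cong _ (λ w → F w ∧ not (S w)) (λ w → mk⇔
      (λ t → let p , q = to (∈F′ false) t
             in from T-∧ (p , from T-not-≡ (trans (sym (β-even even p)) q)))
      (λ t → let p , q = to (T-∧ {F w}) t
             in from (∈F′ false) (p , trans (β-even even p) (to T-not-≡ q))))
      (odd-cancelˡ (count (λ w → F w ∧ S w)) _
        (trans (cong (_% 2) (sym (count-split F S))) even) (special-odd t₀)))

-- Iterating the coarsening step along the chain.

palette : ℕ → ℕ → ℕ
palette N zero    = N
palette N (suc J) = palette N J * 2

determines-chain : ∀ {n N} {κ : Fin n → Fin N} (a : ℕ → Fin n → Fin n) {J} →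
  (∀ j → j < J → Determines κ (a j) (a (suc j))) → ∀ j → j ≤ J → Determines κ (a j) (a J)
determines-chain a {zero}  det zero z≤n w w′ p q = q
determines-chain a {suc J} det j j≤J w w′ p q with ℕₚ.m≤n⇒m<n∨m≡n j≤J
... | inj₂ refl      = q
... | inj₁ (s≤s j≤J) = det J ℕₚ.≤-refl w w′ p
  (determines-chain a (λ i i<J → det i (ℕₚ.m<n⇒m<1+n i<J)) j j≤J w w′ p q)

refinement : ∀ {n N} (κ : Fin n → Fin N) (a : ℕ → Fin n → Fin n) → (∀ w → a 0 w ≡ w) →
  ∀ J → (∀ j → j < J → Determines κ (a j) (a (suc j))) →
  Σ (Fin n → Fin (palette N J)) λ e →
    (∀ w w′ → e w ≡ e w′ → κ w ≡ κ w′) × (∀ j → j ≤ J → Good (a j) e)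
refinement κ a a₀ zero det = κ , (λ _ _ eq → eq) , λ where
  -- `a 0` is the identity, so its fibres have at most one element.
  zero z≤n v i → count-unique λ w w′ t t′ →
    trans (trans (sym (a₀ w)) (proj₁ (to (∈-fibre (a 0) κ) t)))
          (sym (trans (sym (a₀ w′)) (proj₁ (to (∈-fibre (a 0) κ) t′))))
refinement κ a a₀ (suc J) det
  with e , e⇒κ , good ← refinement κ a a₀ J (λ j j<J → det j (ℕₚ.m<n⇒m<1+n j<J)) =
  mark e β , (λ w w′ eq → e⇒κ w w′ (proj₁ (mark-injective e β (e w′) (β w′) eq))) , good′
  where
  -- The hypothesis on `κ` passes to `e`, whose colour classes are smaller.
  det′ : ∀ j → j < suc J → Determines e (a j) (a (suc j))
  det′ j j<J w w′ p = det j j<J w w′ (e⇒κ w w′ p)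
  open Coarsen (a J) (a (suc J)) e (det′ J ℕₚ.≤-refl) (good J ℕₚ.≤-refl)
  good′ : ∀ j → j ≤ suc J → Good (a j) (mark e β)
  good′ j j≤1+J with ℕₚ.m≤n⇒m<n∨m≡n j≤1+J
  ... | inj₂ refl      = good-coarse
  -- Within a colour class `a j` determines `a J`, and `a J` determines `β`, so the finer levels
  -- remain good.
  ... | inj₁ (s≤s j≤J) = good-mark
    (λ w w′ p q → β-det w w′ p (determines-chain a (λ i i<J → det′ i (ℕₚ.m<n⇒m<1+n i<J)) j j≤J w w′ p q))
    (good j j≤J)

-- From reachability colourings to strong odd colourings

argmin : ∀ {n} {P : Fin n → Set} → Decidable P → (f : Fin n → ℕ) →
  (∀ v → ¬ P v) ⊎ Σ (Fin n) λ v → P v × (∀ u → P u → f v ≤ f u)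
argmin {zero} P? f = inj₁ λ ()
argmin {suc n} P? f with P? zero | argmin (P? ∘ suc) (f ∘ suc)
... | no ¬p | inj₁ ∄ = inj₁ λ { zero → ¬p ; (suc v) → ∄ v }
... | no ¬p | inj₂ (v , p , min) = inj₂ (suc v , p , λ where
  zero p₀   → contradiction p₀ ¬p
  (suc u) q → min u q)
... | yes p | inj₁ ∄ = inj₂ (zero , p , λ where
  zero _    → ℕₚ.≤-refl
  (suc u) q → contradiction q (∄ u))
... | yes p | inj₂ (v , q , min) with ℕₚ.≤-total (f zero) (f (suc v))
...   | inj₁ f₀≤ = inj₂ (zero , p , λ where
  zero _    → ℕₚ.≤-refl
  (suc u) r → ℕₚ.≤-trans f₀≤ (min u r))
...   | inj₂ ≤f₀ = inj₂ (suc v , q , λ where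
  zero _    → ≤f₀
  (suc u) r → min u r)

record OrderedGraph : Set where
  field
    graph   : Graph
    key     : Fin (size graph) → ℕ
    key-inj : ∀ {u v} → key u ≡ key v → u ≡ v
  V = Fin (size graph)

  Parent : V → V → Set
  Parent w u = adj graph w u ≡ true × key w < key u

  Parent? : ∀ w u → Dec (Parent w u)
  Parent? w u = (adj graph w u Bool.≟ true) ×-dec (key w ℕ.<? key u)

  Parent⁼ : V → V → Set
  Parent⁼ w u = u ≡ w ⊎ Parent w u

-- In reach-rainbow, u and u′ range over the vertices strongly 2-reachable from v
-- (through w and w′ respectively).
record ReachColoring (O : OrderedGraph) (q : ℕ) : Set where
  open OrderedGraph O
  field
    c : V → Fin q
    reach-rainbow : ∀ {w w′ v u u′} → Parent⁼ w v → Parent⁼ w u → Parent⁼ w′ v → Parent⁼ w′ u′ →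
      key v ≤ key u → key v ≤ key u′ → c u ≡ c u′ → u ≡ u′
    grandparent : ∀ {w v u} → Parent w v → Parent v u → c u ≢ c w

module StrongOdd {O : OrderedGraph} {q : ℕ} (C : ReachColoring O q) where
  open OrderedGraph O
  open ReachColoring C

  key-≤ : ∀ {w u} → Parent⁼ w u → key w ≤ key u
  key-≤ (inj₁ refl)      = ℕₚ.≤-refl
  key-≤ (inj₂ (_ , w<u)) = ℕₚ.<⇒≤ w<u

  -- The case of `reach-rainbow` in which `w` is both the starting vertex and the intermediate one.
  rainbow : ∀ {w u u′} → Parent⁼ w u → Parent⁼ w u′ → c u ≡ c u′ → u ≡ u′
  rainbow p p′ = reach-rainbow (inj₁ refl) p (inj₁ refl) p′ (key-≤ p) (key-≤ p′)

  orient : ∀ {v w} → adj graph v w ≡ true → Parent v w ⊎ Parent w v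
  orient {v} {w} vw with ℕₚ.<-cmp (key v) (key w)
  ... | tri< v<w _ _ = inj₁ (vw , v<w)
  ... | tri≈ _ v≈w _ with refl ← key-inj v≈w with () ← trans (sym vw) (irrefl graph v)
  ... | tri> _ _ v>w = inj₂ (trans (Graph.sym graph w v) vw , v>w)

  -- Chains of ancestors.

  data Next (w x : V) : V → Set where
    last : (∀ u → Parent w u → ¬ key x < key u) → Next w x x
    next : ∀ {y} → Parent w y → key x < key y →
           (∀ u → Parent w u → key x < key u → key y ≤ key u) → Next w x y

  next! : ∀ w x → ∃ (Next w x)
  next! w x with argmin (λ u → Parent? w u ×-dec (key x ℕ.<? key u)) key
  ... | inj₁ ∄ = x , last λ u p x<u → ∄ u (p , x<u)
  ... | inj₂ (y , (p , x<y) , min) = y , next p x<y λ u q x<u → min u (q , x<u)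

  -- Once no larger parent is left, the chain stalls at its last value.
  ancestor : ℕ → V → V
  ancestor zero    w = w
  ancestor (suc j) w = proj₁ (next! w (ancestor j w))

  ancestor-Parent⁼ : ∀ j w → Parent⁼ w (ancestor j w)
  ancestor-Parent⁼ zero    w = inj₁ refl
  ancestor-Parent⁼ (suc j) w with next! w (ancestor j w)
  ... | _ , last _     = ancestor-Parent⁼ j w
  ... | _ , next p _ _ = inj₂ p

  ancestor-≤ : ∀ j w → key (ancestor j w) ≤ key (ancestor (suc j) w)
  ancestor-≤ j w with next! w (ancestor j w)
  ... | _ , last _     = ℕₚ.≤-refl
  ... | _ , next _ x<y _ = ℕₚ.<⇒≤ x<y

  ancestor-mono : ∀ {i j} w → i ≤ j → key (ancestor i w) ≤ key (ancestor j w)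
  ancestor-mono {i} {zero}  w z≤n = ℕₚ.≤-refl
  ancestor-mono {i} {suc j} w i≤j with ℕₚ.m≤n⇒m<n∨m≡n i≤j
  ... | inj₂ refl      = ℕₚ.≤-refl
  ... | inj₁ (s≤s i≤j) = ℕₚ.≤-trans (ancestor-mono w i≤j) (ancestor-≤ j w)

  ancestor-< : ∀ {w v} → Parent w v → ∀ j → key (ancestor j w) < key v →
    key (ancestor j w) < key (ancestor (suc j) w) × key (ancestor (suc j) w) ≤ key v
  ancestor-< {w} {v} p j x<v with next! w (ancestor j w)
  ... | _ , last ∄         = contradiction x<v (∄ v p)
  ... | _ , next _ x<y min = x<y , min v p x<v

  -- Each step goes to the nearest larger parent, so the chain cannot pass `v` without landing on
  -- it.
  ancestor-or-below : ∀ {w v} → Parent w v → ∀ j →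
    (∃ λ i → i ≤ j × ancestor i w ≡ v) ⊎ (∀ i → i ≤ j → key (ancestor i w) < key v)
  ancestor-or-below (_ , w<v) zero = inj₂ λ { zero z≤n → w<v }
  ancestor-or-below {w} {v} p (suc j) with ancestor-or-below p j
  ... | inj₁ (i , i≤j , eq) = inj₁ (i , ℕₚ.m≤n⇒m≤1+n i≤j , eq)
  ... | inj₂ below with ℕₚ.m≤n⇒m<n∨m≡n (proj₂ (ancestor-< p j (below j ℕₚ.≤-refl)))
  ...   | inj₂ eq = inj₁ (suc j , ℕₚ.≤-refl , key-inj eq)
  ...   | inj₁ a<v = inj₂ λ i i≤1+j → case (ℕₚ.m≤n⇒m<n∨m≡n i≤1+j)
    where
    case : ∀ {i} → i < suc j ⊎ i ≡ suc j → key (ancestor i w) < key v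
    case (inj₁ (s≤s i≤j)) = below _ i≤j
    case (inj₂ refl)      = a<v

  -- Otherwise the ancestors with indices 0 to `q` all lie below `v` and thus strictly increase. Two
  -- of these `q + 1` vertices share a colour, against `rainbow`.
  parent-is-ancestor : ∀ {w v} → Parent w v → ∃ λ i → i ≤ q × ancestor i w ≡ v
  parent-is-ancestor {w} {v} p with ancestor-or-below p q
  ... | inj₁ found = found
  ... | inj₂ below
    with i , j , i<j , ci≡cj ← Finₚ.pigeonhole (ℕₚ.n<1+n q) (λ i → c (ancestor (toℕ i) w))
    = contradiction
        (cong key (rainbow (ancestor-Parent⁼ (toℕ i) w) (ancestor-Parent⁼ (toℕ j) w) ci≡cj))
        (ℕₚ.<⇒≢ (ℕₚ.<-≤-trans
          (proj₁ (ancestor-< p (toℕ i) (below (toℕ i) (ℕₚ.≤-pred (Finₚ.toℕ<n i)))))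
          (ancestor-mono w i<j)))

  -- Index 0 records the colour of the vertex itself, and the range up to `q` covers every parent by
  -- `parent-is-ancestor`.
  profile : V → Fin (suc q) → Fin q
  profile w i = c (ancestor (toℕ i) w)

  κ : V → Fin (q ^ suc q)
  κ w = funToFin (profile w)

  κ⇒c : ∀ {w w′} → κ w ≡ κ w′ → ∀ j → j ≤ q → c (ancestor j w) ≡ c (ancestor j w′)
  κ⇒c {w} {w′} eq j j≤q = subst (λ j → c (ancestor j w) ≡ c (ancestor j w′)) (Finₚ.toℕ-fromℕ< (s≤s j≤q))
    (trans (sym (Finₚ.finToFun-funToFin (profile w) i))
    (trans (cong (λ k → finToFun {q} {suc q} k i) eq) (Finₚ.finToFun-funToFin (profile w′) i)))
    where i = fromℕ< (s≤s j≤q)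

  -- From the common `j`-th ancestor, the two next ancestors are 2-reachable through `w` and `w′`,
  -- and equal profiles give them equal colours.
  κ-determines : ∀ j → j < q → Determines κ (ancestor j) (ancestor (suc j))
  κ-determines j j<q w w′ p eq = reach-rainbow
    (ancestor-Parent⁼ j w) (ancestor-Parent⁼ (suc j) w)
    (subst (Parent⁼ w′) (sym eq) (ancestor-Parent⁼ j w′)) (ancestor-Parent⁼ (suc j) w′)
    (ancestor-≤ j w) (subst (λ v → key v ≤ _) (sym eq) (ancestor-≤ j w′))
    (κ⇒c p (suc j) j<q)

  strongOddColorable : StrongOddColorable graph (palette (q ^ suc q) q)
  strongOddColorable
    with e , e⇒κ , good ← refinement κ ancestor (λ _ → refl) q κ-determines = e , proper , odd
    where
    e⇒c : ∀ {u v} → e u ≡ e v → c u ≡ c v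
    e⇒c eq = κ⇒c (e⇒κ _ _ eq) 0 z≤n

    parent≢ : ∀ {w u} → Parent w u → e u ≢ e w
    parent≢ p eq = ℕₚ.<⇒≢ (proj₂ p) (cong key (sym (rainbow (inj₂ p) (inj₁ refl) (e⇒c eq))))

    proper : ∀ u v → adj graph u v ≡ true → e u ≢ e v
    proper u v uv with orient uv
    ... | inj₁ p = parent≢ p ∘ sym
    ... | inj₂ p = parent≢ p

    nbr : V → Fin _ → V → Bool
    nbr v i u = adj graph v u ∧ ⌊ e u Fin.≟ i ⌋

    ∈-nbr : ∀ v i u → T (nbr v i u) → (Parent v u ⊎ Parent u v) × e u ≡ i
    ∈-nbr v i u t = let p , q = to (T-∧ {adj graph v u}) t in orient (to T-≡ p) , toWitness q

    odd : ∀ v i → OddOrZero (colorNbrs graph e v i)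
    odd v i with Finₚ.any? (λ u → Parent? v u ×-dec (e u Fin.≟ i))
    -- A parent `u₀` of colour `i` is the only neighbour of that colour: `rainbow` excludes a second
    -- parent, and `grandparent` excludes a child of `v`, whose grandparent would be `u₀`.
    ... | yes (u₀ , p₀ , refl) = count-unique λ u u′ t t′ → trans (only u t) (sym (only u′ t′))
      where
      only : ∀ u → T (nbr v (e u₀) u) → u ≡ u₀
      only u t with ∈-nbr v (e u₀) u t
      ... | inj₁ p , eq = rainbow (inj₂ p) (inj₂ p₀) (e⇒c eq)
      ... | inj₂ p , eq = contradiction (sym (e⇒c eq)) (grandparent p p₀)
    ... | no ∄parent with Finₚ.any? (λ w → Parent? w v ×-dec (e w Fin.≟ i))
    ...   | no ∄child = inj₁ (count-none (nbr v i) none)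
      where
      none : ∀ u → ¬ T (nbr v i u)
      none u t with ∈-nbr v i u t
      ... | inj₁ p , eq = ∄parent (u , p , eq)
      ... | inj₂ p , eq = ∄child (u , p , eq)
    -- The index `j` found for one child serves all children of colour `i`, since equal `e` gives
    -- equal profiles.
    ...   | yes (w₀ , p₀ , refl) with j , j≤q , a₀ ← parent-is-ancestor p₀ =
      subst OddOrZero (sym (count-cong (nbr v i) (fibre (ancestor j) e v i) same)) (good j j≤q v i)
      where
      c-ancestor : ∀ {w} → e w ≡ i → c (ancestor j w) ≡ c v
      c-ancestor eq = trans (κ⇒c (e⇒κ _ _ eq) j j≤q) (cong c a₀)

      child⇒fibre : ∀ w → T (nbr v i w) → T (fibre (ancestor j) e v i w)
      child⇒fibre w t with ∈-nbr v i w t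
      ... | inj₁ p , eq = contradiction (w , p , eq) ∄parent
      ... | inj₂ p , eq = from (∈-fibre (ancestor j) e)
        (rainbow (ancestor-Parent⁼ j w) (inj₂ p) (c-ancestor eq) , eq)

      fibre⇒child : ∀ w → T (fibre (ancestor j) e v i w) → T (nbr v i w)
      fibre⇒child w t with a≡v , eq ← to (∈-fibre (ancestor j) e {v} {i} {w}) t
        with subst (Parent⁼ w) a≡v (ancestor-Parent⁼ j w)
      -- `v` itself is not in the fibre, because its colour differs from that of its child `w₀`.
      ... | inj₁ refl     = contradiction eq (parent≢ p₀)
      ... | inj₂ (wv , _) = from T-∧
        (from T-≡ (trans (Graph.sym graph v w) wv) , fromWitness eq)

      same : ∀ w → T (nbr v i w) ⇔ T (fibre (ancestor j) e v i w)
      same w = mk⇔ (child⇒fibre w) (fibre⇒child w)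

-- Reachability colourings of subgraphs of H ⊠ P

fresh : ∀ {Q} (xs : List (Fin Q)) → length xs < Q → ∃ λ i → i ∉ xs
fresh {Q} xs short with Finₚ.all? (_∈? xs)
  where open DecMembership (Fin._≟_ {Q}) using (_∈?_)
... | yes all = contradiction (Finₚ.injective⇒≤ {f = λ i → index (all i)} injective) (ℕₚ.<⇒≱ short)
  where
  injective : ∀ {i j} → index (all i) ≡ index (all j) → i ≡ j
  injective {i} {j} eq = trans (lookup-index (all i))
    (trans (cong (List.lookup xs) eq) (sym (lookup-index (all j))))
... | no ¬all = Finₚ.¬∀⟶∃¬ Q (_∈ xs) (_∈? xs) ¬all
  where open DecMembership (Fin._≟_ {Q}) using (_∈?_)

length-concatMap-≤ : ∀ {A B : Set} {k} (f : A → List B) → (∀ x → length (f x) ≤ k) →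
  ∀ xs → length (concatMap f xs) ≤ length xs * k
length-concatMap-≤ f f≤ []       = z≤n
length-concatMap-≤ f f≤ (x ∷ xs) = ℕₚ.≤-trans (ℕₚ.≤-reflexive (Listₚ.length-++ (f x)))
  (ℕₚ.+-mono-≤ (f≤ x) (length-concatMap-≤ f f≤ xs))

-- Elimination orderings and greedy colourings of k-trees.

elements : ∀ {n} → Subset n → List (Fin n)
elements []          = []
elements (true ∷ S)  = zero ∷ map suc (elements S)
elements (false ∷ S) = map suc (elements S)

length-elements : ∀ {n} (S : Subset n) → length (elements S) ≡ card S
length-elements []          = refl
length-elements (true ∷ S)  = cong suc (trans (Listₚ.length-map suc (elements S)) (length-elements S))
length-elements (false ∷ S) = trans (Listₚ.length-map suc (elements S)) (length-elements S)

∈-elements : ∀ {n} (S : Subset n) v → lookup S v ≡ true → v ∈ elements S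
∈-elements (true ∷ S)  zero    _  = here refl
∈-elements (true ∷ S)  (suc v) eq = there (∈-map⁺ suc (∈-elements S v eq))
∈-elements (false ∷ S) (suc v) eq = ∈-map⁺ suc (∈-elements S v eq)

-- New vertices of a k-tree get index zero (see extend), so Up points towards the older ones.
Up : ∀ {n} → Adj n → Fin n → Fin n → Set
Up a v u = v Fin.< u × a v u ≡ true

-- A perfect elimination ordering together with a colouring that also separates the ends of upward
-- paths of length two. The list `up v` may contain more than the upper neighbours of `v`.
record Elimination {n} (a : Adj n) (k Q : ℕ) : Set where
  field
    up        : Fin n → List (Fin n)
    up-length : ∀ v → length (up v) ≤ k
    up-∈      : ∀ {v u} → Up a v u → u ∈ up v
    chordal   : ∀ {w v u} → Up a w v → Up a w u → v ≢ u → a v u ≡ true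
    colour    : Fin n → Fin Q
    proper    : ∀ {v u} → a v u ≡ true → colour v ≢ colour u
    distance2 : ∀ {w v u} → Up a w v → Up a v u → colour u ≢ colour w

complete-≢ : ∀ {k} (u v : Fin k) → complete k u v ≡ true → u ≢ v
complete-≢ u v eq u≡v with u Fin.≟ v
... | no u≢v = u≢v u≡v

≢-complete : ∀ {k} {u v : Fin k} → u ≢ v → complete k u v ≡ true
≢-complete {u = u} {v} u≢v with u Fin.≟ v
... | yes u≡v = contradiction u≡v u≢v
... | no _    = refl

complete-elimination : ∀ k {Q} → k ≤ Q → Elimination (complete k) k Q
complete-elimination k k≤Q = record
  { up        = λ _ → allFin k
  ; up-length = λ _ → ℕₚ.≤-reflexive (Listₚ.length-tabulate {n = k} (λ i → i))
  ; up-∈      = λ _ → ∈-allFin _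
  ; chordal   = λ _ _ → ≢-complete
  ; colour    = λ v → inject≤ v k≤Q
  ; proper    = λ {v} {u} vu → complete-≢ v u vu ∘ Finₚ.inject≤-injective k≤Q k≤Q v u
  ; distance2 = λ {w} {v} {u} (w<v , _) (v<u , _) eq → ℕₚ.<⇒≢ (ℕₚ.<-trans w<v v<u)
      (cong toℕ (sym (Finₚ.inject≤-injective k≤Q k≤Q u w eq)))
  }

-- The new vertex has index zero, so it is never the upper end of an `Up` pair and old vertices keep
-- their colours. Its own colour only has to avoid those on `S` and on the lists `up` of members of
-- `S`, at most `k + k * k` in all.
extend-elimination : ∀ {n k} {a : Adj n} (S : Subset n) → IsClique a k S →
  Elimination a k (suc (k + k * k)) → Elimination (extend a S) k (suc (k + k * k))
extend-elimination {n} {k} {a} S (∣S∣ , clique) E = record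
  { up        = up′
  ; up-length = up-length′
  ; up-∈      = up-∈′
  ; chordal   = chordal′
  ; colour    = colour′
  ; proper    = λ {v} → proper′ {v}
  ; distance2 = distance2′
  }
  where
  open Elimination E
  near = elements S ++ concatMap up (elements S)

  near-length : length (map colour near) < suc (k + k * k)
  near-length = s≤s (begin
    length (map colour near)                                   ≡⟨ Listₚ.length-map colour near ⟩
    length near                                                ≡⟨ Listₚ.length-++ (elements S) ⟩
    length (elements S) + length (concatMap up (elements S))   ≤⟨ ℕₚ.+-monoʳ-≤ (length (elements S)) (length-concatMap-≤ up up-length (elements S)) ⟩
    length (elements S) + length (elements S) * k              ≡⟨ cong (λ m → m + m * k) (trans (length-elements S) ∣S∣) ⟩
    k + k * k                                                  ∎)
    where open ℕₚ.≤-Reasoning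

  new : ∃ λ i → i ∉ map colour near
  new = fresh (map colour near) near-length

  colour′ : Fin (suc n) → Fin (suc (k + k * k))
  colour′ zero    = proj₁ new
  colour′ (suc v) = colour v

  colour-new : ∀ {v} → v ∈ near → colour v ≢ proj₁ new
  colour-new v∈ eq = proj₂ new (subst (_∈ map colour near) eq (∈-map⁺ colour v∈))

  up′ : Fin (suc n) → List (Fin (suc n))
  up′ zero    = map suc (elements S)
  up′ (suc v) = map suc (up v)

  up-length′ : ∀ v → length (up′ v) ≤ k
  up-length′ zero    = ℕₚ.≤-reflexive (trans (Listₚ.length-map suc (elements S)) (trans (length-elements S) ∣S∣))
  up-length′ (suc v) = ℕₚ.≤-trans (ℕₚ.≤-reflexive (Listₚ.length-map suc (up v))) (up-length v)

  up-∈′ : ∀ {v u} → Up (extend a S) v u → u ∈ up′ v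
  up-∈′ {zero}  {suc u} (_ , eq)       = ∈-map⁺ suc (∈-elements S u eq)
  up-∈′ {suc v} {suc u} (s≤s v<u , eq) = ∈-map⁺ suc (up-∈ (v<u , eq))

  chordal′ : ∀ {w v u} → Up (extend a S) w v → Up (extend a S) w u → v ≢ u → extend a S v u ≡ true
  chordal′ {zero}  {suc v} {suc u} (_ , wv) (_ , wu) v≢u =
    clique v u (lookup⇒[]= v S wv) (lookup⇒[]= u S wu) (v≢u ∘ cong suc)
  chordal′ {suc w} {suc v} {suc u} (s≤s w<v , wv) (s≤s w<u , wu) v≢u =
    chordal (w<v , wv) (w<u , wu) (v≢u ∘ cong suc)

  proper′ : ∀ {v u} → extend a S v u ≡ true → colour′ v ≢ colour′ u
  proper′ {zero}  {suc u} eq = colour-new (∈-++⁺ˡ (∈-elements S u eq)) ∘ sym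
  proper′ {suc v} {zero}  eq = colour-new (∈-++⁺ˡ (∈-elements S v eq))
  proper′ {suc v} {suc u} eq = proper eq

  distance2′ : ∀ {w v u} → Up (extend a S) w v → Up (extend a S) v u → colour′ u ≢ colour′ w
  distance2′ {zero}  {suc v} {suc u} (_ , wv) (s≤s v<u , vu) =
    colour-new (∈-++⁺ʳ (elements S) (∈-concatMap⁺ up (lose (∈-elements S v wv) (up-∈ (v<u , vu)))))
  distance2′ {suc w} {suc v} {suc u} (s≤s w<v , wv) (s≤s v<u , vu) = distance2 (w<v , wv) (v<u , vu)

k≤1+k+k² : ∀ k → k ≤ suc (k + k * k)
k≤1+k+k² k = ℕₚ.m≤n⇒m≤1+n (ℕₚ.m≤m+n k (k * k))

kTree-elimination : ∀ {k n a} → KTree k n a → Elimination a k (suc (k + k * k))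
kTree-elimination {k} base = complete-elimination k (k≤1+k+k² k)
kTree-elimination (step S T clique) = extend-elimination S clique (kTree-elimination T)

-- Rows modulo 5 and the colouring of the product.

close-congruent⇒≡ : ∀ x y → x % 5 ≡ y % 5 → ∣ x - y ∣ < 5 → x ≡ y
close-congruent⇒≡ x y eq close = ℕₚ.∣m-n∣≡0⇒m≡n
  -- The distance is 5 times that of the quotients; being below 5, it must be zero.
  (trans distance (cong (_* 5) (ℕₚ.n<1⇒n≡0 (ℕₚ.*-cancelʳ-< 5 ∣ x / 5 - y / 5 ∣ 1 (subst (_< 5) distance close)))))
  where
  open ≡-Reasoning
  distance : ∣ x - y ∣ ≡ ∣ x / 5 - y / 5 ∣ * 5
  distance = begin
    ∣ x - y ∣                                         ≡⟨ cong₂ ∣_-_∣ (m≡m%n+[m/n]*n x 5) (m≡m%n+[m/n]*n y 5) ⟩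
    ∣ x % 5 + x / 5 * 5 - y % 5 + y / 5 * 5 ∣         ≡⟨ cong (λ r → ∣ x % 5 + x / 5 * 5 - r + y / 5 * 5 ∣) eq ⟨
    ∣ x % 5 + x / 5 * 5 - x % 5 + y / 5 * 5 ∣         ≡⟨ ℕₚ.∣m+n-m+o∣≡∣n-o∣ (x % 5) _ _ ⟩
    ∣ x / 5 * 5 - y / 5 * 5 ∣                         ≡⟨ ℕₚ.*-distribʳ-∣-∣ 5 (x / 5) (y / 5) ⟨
    ∣ x / 5 - y / 5 ∣ * 5                             ∎

∣-∣-via : ∀ {m n} x y z → ∣ x - y ∣ ≤ m → ∣ y - z ∣ ≤ n → ∣ x - z ∣ ≤ m + n
∣-∣-via x y z p q = ℕₚ.≤-trans (ℕₚ.∣-∣-triangle x y z) (ℕₚ.+-mono-≤ p q)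

∣-∣-sym-≤ : ∀ {m} x y → ∣ x - y ∣ ≤ m → ∣ y - x ∣ ≤ m
∣-∣-sym-≤ x y = subst (_≤ _) (ℕₚ.∣-∣-comm x y)

module ProductColoring {k Q h m} {a : Adj h} (E : Elimination a k Q)
                       (G : Graph) (embedding : SubgraphOfProduct G a m) where
  open Elimination E

  g = proj₁ embedding

  column : Fin (size G) → Fin h
  column v = proj₁ (g v)

  row : Fin (size G) → ℕ
  row v = toℕ (proj₂ (g v))

  g-≡ : ∀ {u v} → column u ≡ column v → row u ≡ row v → u ≡ v
  g-≡ p q = proj₁ (proj₂ embedding) (cong₂ _,_ p (Finₚ.toℕ-injective q))

  -- Lexicographic order with the column first, ties being broken by the row.
  position : Fin (size G) → ℕ
  position v = toℕ (combine (column v) (proj₂ (g v)))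

  position-injective : ∀ {u v} → position u ≡ position v → u ≡ v
  position-injective eq =
    let p , q = Finₚ.combine-injective _ _ _ _ (Finₚ.toℕ-injective eq) in g-≡ p (cong toℕ q)

  position-column : ∀ {u v} → position u ≤ position v → column u Fin.≤ column v
  position-column u≤v = ℕₚ.≮⇒≥ λ v<u → ℕₚ.<⇒≱ (Finₚ.combine-monoˡ-< _ _ v<u) u≤v

  ordered : OrderedGraph
  ordered = record { graph = G ; key = position ; key-inj = position-injective }

  open OrderedGraph ordered using (Parent; Parent⁼)

  Up⁼ : Fin h → Fin h → Set
  Up⁼ v u = u ≡ v ⊎ Up a v u

  up⁼-≤ : ∀ {v u} → v Fin.≤ u → v ≢ u → a v u ≡ true → Up⁼ v u
  up⁼-≤ v≤u v≢u vu = inj₂ (ℕₚ.≤∧≢⇒< v≤u (v≢u ∘ Finₚ.toℕ-injective) , vu)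

  parent-column : ∀ {w u} → Parent w u → Up⁼ (column w) (column u)
  parent-column {w} {u} (wu , w<u) with proj₁ (proj₂ (proj₂ (proj₂ embedding) w u wu))
  ... | inj₁ eq = inj₁ (sym eq)
  ... | inj₂ au with column u Fin.≟ column w
  ...   | yes eq = inj₁ eq
  ...   | no ≢   = up⁼-≤ (position-column (ℕₚ.<⇒≤ w<u)) (≢ ∘ sym) au

  parent⁼-column : ∀ {w u} → Parent⁼ w u → Up⁼ (column w) (column u)
  parent⁼-column (inj₁ refl) = inj₁ refl
  parent⁼-column (inj₂ p)    = parent-column p

  parent⁼-row : ∀ {w u} → Parent⁼ w u → ∣ row w - row u ∣ ≤ 1
  parent⁼-row {w} (inj₁ refl) = ℕₚ.≤-trans (ℕₚ.≤-reflexive (ℕₚ.∣n-n∣≡0 (row w))) z≤n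
  parent⁼-row {w} {u} (inj₂ (wu , _)) with proj₂ (proj₂ (proj₂ (proj₂ embedding) w u wu))
  ... | inj₁ eq = ℕₚ.≤-trans (ℕₚ.≤-reflexive (ℕₚ.m≡n⇒∣m-n∣≡0 (cong toℕ eq))) z≤n
  ... | inj₂ eq = ℕₚ.≤-reflexive eq

  -- Chordality collapses 2-reachability in `H`: going from `v` down to `w` and up to some `u` not
  -- below `v` ends at `v` or at one of its upper neighbours.
  up⁼-chordal : ∀ {w v u} → Up⁼ w v → Up⁼ w u → v Fin.≤ u → Up⁼ v u
  up⁼-chordal (inj₁ refl) wu _ = wu
  up⁼-chordal (inj₂ (w<v , _)) (inj₁ refl) v≤u = contradiction v≤u (ℕₚ.<⇒≱ w<v)
  up⁼-chordal {w} {v} {u} (inj₂ wv) (inj₂ wu) v≤u with v Fin.≟ u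
  ... | yes refl = inj₁ refl
  ... | no v≢u   = up⁼-≤ v≤u v≢u (chordal wv wu v≢u)

  -- A vertex and its upper neighbours form a clique of `H`, on which a proper colouring is
  -- injective.
  up⁼-rainbow : ∀ {v u u′} → Up⁼ v u → Up⁼ v u′ → colour u ≡ colour u′ → u ≡ u′
  up⁼-rainbow (inj₁ refl) (inj₁ refl) _ = refl
  up⁼-rainbow (inj₁ refl) (inj₂ (_ , vu)) eq = contradiction eq (proper vu)
  up⁼-rainbow (inj₂ (_ , vu)) (inj₁ refl) eq = contradiction (sym eq) (proper vu)
  up⁼-rainbow {_} {u} {u′} (inj₂ vu) (inj₂ vu′) eq with u Fin.≟ u′
  ... | yes u≡u′ = u≡u′
  ... | no u≢u′  = contradiction eq (proper (chordal vu vu′ u≢u′))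

  up⁼-distance2 : ∀ {w v u} → Up⁼ w v → Up⁼ v u → colour u ≡ colour w → u ≡ w
  up⁼-distance2 (inj₁ refl) vu          eq = up⁼-rainbow vu (inj₁ refl) eq
  up⁼-distance2 (inj₂ wv)   (inj₁ refl) eq = up⁼-rainbow (inj₂ wv) (inj₁ refl) eq
  up⁼-distance2 (inj₂ wv)   (inj₂ vu)   eq = contradiction eq (distance2 wv vu)

  -- Two vertices strongly 2-reachable from v lie at most 4 rows apart, hence the modulus 5.
  c : Fin (size G) → Fin (Q * 5)
  c v = combine (colour (column v)) (fromℕ< (m%n<n (row v) 5))

  c-≡ : ∀ {u v} → c u ≡ c v → colour (column u) ≡ colour (column v) × row u % 5 ≡ row v % 5
  c-≡ {u} {v} eq =
    let p , q = Finₚ.combine-injective (colour (column u)) _ (colour (column v)) _ eq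
    in p , Finₚ.fromℕ<-injective _ _ _ _ q

  rows-close : ∀ {w v u} → Parent⁼ w v → Parent⁼ w u → ∣ row v - row u ∣ ≤ 2
  rows-close {w} {v} {u} p q =
    ∣-∣-via (row v) (row w) (row u) (∣-∣-sym-≤ (row w) (row v) (parent⁼-row p)) (parent⁼-row q)

  reachColoring : ReachColoring ordered (Q * 5)
  reachColoring = record
    { c = c
    ; reach-rainbow = λ {w} {w′} {v} {u} {u′} wv wu w′v w′u′ v≤u v≤u′ eq →
        let ≡colour , ≡row = c-≡ eq in
        g-≡ (up⁼-rainbow (up⁼-chordal (parent⁼-column wv) (parent⁼-column wu) (position-column v≤u))
                         (up⁼-chordal (parent⁼-column w′v) (parent⁼-column w′u′) (position-column v≤u′))
                         ≡colour)
            (close-congruent⇒≡ (row u) (row u′) ≡row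
              (s≤s (∣-∣-via (row u) (row v) (row u′) (rows-close wu wv) (rows-close w′v w′u′))))
    ; grandparent = λ {w} {v} {u} wv vu eq →
        let ≡colour , ≡row = c-≡ eq in
        -- Equal colours would put `u` and `w` in the same column and, being at most 2 rows apart,
        -- in the same row; yet positions strictly increase from `w` to `v` to `u`.
        ℕₚ.<⇒≢ (ℕₚ.<-trans (proj₂ wv) (proj₂ vu)) (sym (cong position
          (g-≡ (up⁼-distance2 (parent-column wv) (parent-column vu) ≡colour)
               (close-congruent⇒≡ (row u) (row w) ≡row
                 (ℕₚ.≤-trans (s≤s (∣-∣-sym-≤ (row w) (row u)
                   (∣-∣-via (row w) (row v) (row u) (parent⁼-row (inj₂ wv)) (parent⁼-row (inj₂ vu)))))
                   (s≤s (s≤s (s≤s z≤n))))))))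
    }

-- Here `q` counts pairs of a colour in `H` and a row residue. The palette consists of `q ^ suc q`
-- profiles with one bit for each of `q` coarsening steps.
bound : ℕ → ℕ
bound k = palette (q ^ suc q) q
  where q = suc (k + k * k) * 5

theorem12 : Σ (ℕ → ℕ) (λ f → (G : Graph) (k c : ℕ) →
    IsRowTreewidth G k → IsStrongOddChromatic G c → c ≤ f k)
theorem12 = bound , λ G k c ((h , a , tree , m , embedding) , _) (_ , minimal) →
  -- A colouring with `bound k` colours exists, so minimality of `c` forbids `bound k < c`.
  ℕₚ.≮⇒≥ λ f<c → minimal (bound k) f<c
    (StrongOdd.strongOddColorable
      (ProductColoring.reachColoring (kTree-elimination tree) G embedding))
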